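{- For every positive integer $r$, $\delta(23r)\ge 8r$. Consequently $\liminf_{n\to\infty} \delta(n)/n \ge 8/23$.
   Context: A double-$n$ string is a string of length $2n$ over an alphabet of $n$ symbols in which each symbol appears exactly twice. Positions in the string are numbered $1,\dots,2n$. The distance between two distinct symbols is the minimum, over an occurrence of the first symbol and an occurrence of the second, of the absolute difference of their positions. The diameter of a double-$n$ string ($n\ge 2$) is the maximum of the distance over all pairs of distinct symbols. $\delta(n)$ denotes the minimum diameter over all double-$n$ strings. -}

module Defs where

open import Data.Bool.Base using (true; false)
open import Data.Fin using (Fin; zero; suc; toℕ; _≟_)
open import Data.Fin.Properties using (all?)
open import Data.Integer.Base using (+_)
open import Data.List as List using (List; []; _∷_; cartesianProduct; cartesianProductWith; filter)
open import Data.List.Extrema.Nat using (max; min; argmin-sel; min≤⊤; min≤xs)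
open import Data.List.Membership.Propositional using (_∈_)
open import Data.List.Membership.Propositional.Properties
  using (∈-allFin; ∈-cartesianProductWith⁺; ∈-filter⁺; ∈-filter⁻; ∈-map⁺; ∈-map⁻)
open import Data.List.Relation.Unary.All as All using ()
open import Data.List.Relation.Unary.Any using (here; there)
open import Data.Nat.Base using (ℕ; zero; suc; _+_; _*_; _≤_; NonZero; ∣_-_∣)
import Data.Nat.Properties as ℕ
open import Data.Product using (_×_; _,_; ∃-syntax; uncurry; proj₂)
open import Data.Rational.Base as ℚ using (ℚ; _/_)
open import Data.Sum.Base using (inj₁; inj₂)
open import Data.Vec as Vec using (Vec; []; _∷_; count; lookup; _++_; tabulate)
open import Function.Base using (_∘_; id)
open import Relation.Binary.PropositionalEquality
  using (_≡_; _≢_; refl; trans; cong; cong₂)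
open import Relation.Nullary using (yes; no; does; ¬?; contradiction)
open import Relation.Unary using (Decidable)

-- The value 0 on the empty list is a junk value.
minimum : List ℕ → ℕ
minimum []       = 0
minimum (x ∷ xs) = min x xs

-- Symbols and positions are numbered from 0; shifting the positions from
-- 1, …, 2n does not change their differences.
Word : ℕ → Set
Word n = Vec (Fin n) (2 * n)

IsDouble : ∀ {n} → Word n → Set
IsDouble w = ∀ a → count (_≟ a) w ≡ 2

isDouble? : ∀ {n} → Decidable (IsDouble {n})
isDouble? w = all? (λ a → count (_≟ a) w ℕ.≟ 2)

positions : ∀ {n} → Word n → Fin n → List (Fin (2 * n))
positions w a = filter (λ i → lookup w i ≟ a) (List.allFin _)

distance : ∀ {n} → Word n → Fin n → Fin n → ℕ
distance w a b =
  minimum (cartesianProductWith (λ i j → ∣ toℕ i - toℕ j ∣) (positions w a) (positions w b))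

distinctPairs : ∀ n → List (Fin n × Fin n)
distinctPairs n =
  filter (λ (a , b) → ¬? (a ≟ b)) (cartesianProduct (List.allFin n) (List.allFin n))

diameter : ∀ {n} → Word n → ℕ
diameter {n} w = max 0 (List.map (uncurry (distance w)) (distinctPairs n))

allVecs : ∀ n m → List (Vec (Fin n) m)
allVecs n zero    = [] ∷ []
allVecs n (suc m) = cartesianProductWith _∷_ (List.allFin n) (allVecs n m)

doubleWords : ∀ n → List (Word n)
doubleWords n = filter isDouble? (allVecs n (2 * n))

-- Only meaningful for n ≥ 2, like the diameter itself.
δ : ℕ → ℕ
δ n = minimum (List.map diameter (doubleWords n))

δ/n : ∀ n → .{{NonZero n}} → ℚ
δ/n n = + δ n / n

-- "c ≤ lim inf aₙ" for the extended real number lim inf aₙ = sup_N inf_{n ≥ N} aₙ,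
-- which need not be rational: the supremum is at least c iff every rational q < c is
-- a lower bound of some tail of the sequence (which starts at n = 1).
infix 4 _≤liminf_

_≤liminf_ : ℚ → (∀ n → .{{NonZero n}} → ℚ) → Set
c ≤liminf a = ∀ q → q ℚ.< c → ∃[ N ] (∀ n → .{{_ : NonZero n}} → N ≤ n → q ℚ.≤ a n)

------------------------------------------------------------------------
-- δ n is the minimum diameter of the double words: the list doubleWords n
-- contains exactly those words, and it is never empty.

minimum-≤ : ∀ {xs x} → x ∈ xs → minimum xs ≤ x
minimum-≤ {y ∷ xs} (here refl) = min≤⊤ y xs
minimum-≤ {y ∷ xs} (there x∈)  = All.lookup (min≤xs y xs) x∈

minimum-∈ : ∀ {xs x} → x ∈ xs → minimum xs ∈ xs
minimum-∈ {y ∷ xs} _ with argmin-sel id y xs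
... | inj₁ eq = here eq
... | inj₂ m∈ = there m∈

∈-allVecs : ∀ {n m} (w : Vec (Fin n) m) → w ∈ allVecs n m
∈-allVecs []      = here refl
∈-allVecs (x ∷ w) = ∈-cartesianProductWith⁺ _∷_ (∈-allFin x) (∈-allVecs w)

∈-doubleWords : ∀ {n} (w : Word n) → IsDouble w → w ∈ doubleWords n
∈-doubleWords w dw = ∈-filter⁺ isDouble? (∈-allVecs w) dw

private
  count-++ : ∀ {n m k} (a : Fin n) (v : Vec (Fin n) m) (w : Vec (Fin n) k) →
             count (_≟ a) (v ++ w) ≡ count (_≟ a) v + count (_≟ a) w
  count-++ a []      w = refl
  count-++ a (x ∷ v) w with does (x ≟ a)
  ... | true  = cong suc (count-++ a v w)
  ... | false = count-++ a v w

  count-tabulate-0 : ∀ {n m} (a : Fin n) (f : Fin m → Fin n) → (∀ i → f i ≢ a) →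
                     count (_≟ a) (tabulate f) ≡ 0
  count-tabulate-0 {m = zero}  a f f≢a = refl
  count-tabulate-0 {m = suc m} a f f≢a with f zero ≟ a
  ... | yes eq = contradiction eq (f≢a zero)
  ... | no  _  = count-tabulate-0 a (f ∘ suc) (f≢a ∘ suc)

  count-tabulate-1 : ∀ {n m} (f : Fin m → Fin n) → (∀ {i j} → f i ≡ f j → i ≡ j) →
                     ∀ i → count (_≟ f i) (tabulate f) ≡ 1
  count-tabulate-1 f inj zero with f zero ≟ f zero
  ... | yes _  = cong suc (count-tabulate-0 (f zero) (f ∘ suc) (λ i eq → contradiction (inj eq) λ ()))
  ... | no ¬eq = contradiction refl ¬eq
  count-tabulate-1 f inj (suc i) with f zero ≟ f (suc i)
  ... | yes eq = contradiction (inj eq) λ ()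
  ... | no  _  = count-tabulate-1 (f ∘ suc) (λ eq → suc-inj (inj eq)) i
    where
    suc-inj : ∀ {n} {i j : Fin n} → suc i ≡ suc j → i ≡ j
    suc-inj refl = refl

squareWord : ∀ n → Word n
squareWord n = Vec.allFin n ++ (Vec.allFin n ++ [])

squareWord-isDouble : ∀ n → IsDouble (squareWord n)
squareWord-isDouble n a =
  trans (count-++ a (Vec.allFin n) _)
        (cong₂ _+_ once (trans (count-++ a (Vec.allFin n) []) (cong (_+ 0) once)))
  where
  once = count-tabulate-1 id id a

δ-minimal : ∀ {n} (w : Word n) → IsDouble w → δ n ≤ diameter w
δ-minimal w dw = minimum-≤ (∈-map⁺ diameter (∈-doubleWords w dw))

δ-attained : ∀ n → ∃[ w ] (IsDouble {n} w × δ n ≡ diameter w)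
δ-attained n
  with w , w∈ , eq ← ∈-map⁻ diameter (minimum-∈
         (∈-map⁺ diameter (∈-doubleWords (squareWord n) (squareWord-isDouble n))))
  = w , proj₂ (∈-filter⁻ isDouble? {xs = allVecs n (2 * n)} w∈) , eq

{-# OPTIONS --safe #-}
module Submission where

open import Defs
open import Data.Nat.Base using (ℕ; _*_; _≥_; NonZero)
open import Data.Integer.Base using (+_)
open import Data.Rational.Base using (_/_)
open import Data.Product using (_×_)

open import Data.Bool.Base using (true; false)
open import Data.Empty using (⊥)
open import Data.Fin.Base using (Fin; zero; suc; toℕ; fromℕ<; inject≤; opposite)
open import Data.Fin.Properties using
  (toℕ-injective; toℕ-inject≤; toℕ-fromℕ<; toℕ<n; injective⇒≤; any?; opposite-prop; opposite-involutive)
import Data.Fin.Properties as Fin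
open import Data.Integer.Base as ℤ using (+≤+)
import Data.Integer.Properties as ℤ
open import Data.List.Base using
  (List; []; _∷_; _++_; length; filter; map; tabulate; allFin; upTo; applyUpTo)
open import Data.List.Properties using
  (length-++; length-map; length-applyUpTo; length-upTo; length-tabulate; filter-accept)
open import Data.List.Extrema.Nat using (xs≤max)
open import Data.List.Membership.Propositional using (_∈_)
open import Data.List.Membership.Propositional.Properties using
  ( ∈-++⁺ˡ; ∈-++⁺ʳ; ∈-map⁺; ∈-filter⁺; ∈-filter⁻; ∈-allFin; ∈-upTo⁺; ∈-applyUpTo⁺
  ; ∈-cartesianProductWith⁺; ∈-cartesianProductWith⁻; ∈-cartesianProduct⁺)
import Data.List.Membership.Setoid.Properties as Membership
open import Data.List.Relation.Binary.Sublist.Heterogeneous.Properties using (length-mono-≤; ⊆-filter-Sublist)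
open import Data.List.Relation.Binary.Sublist.Propositional using (⊆-refl)
open import Data.List.Relation.Unary.All as All using ()
open import Data.List.Relation.Unary.Any using (here; there; index)
open import Data.Nat.Base using (zero; suc; _+_; _∸_; _≤_; _<_; z≤n; s≤s; s≤s⁻¹; ∣_-_∣)
open import Data.Nat.DivMod using (_%_; m≡m%n+[m/n]*n; m%n<n)
import Data.Nat.DivMod as DivMod
open import Data.Nat.Properties
open import Data.Nat.Tactic.RingSolver using (solve-∀)
open import Data.Product using (∃-syntax; _,_; proj₁; proj₂; uncurry)
import Data.Rational.Base as ℚ
import Data.Rational.Properties as ℚ
import Data.Rational.Unnormalised.Base as ℚᵘ
import Data.Rational.Unnormalised.Properties as ℚᵘ
open import Data.Sum.Base using (_⊎_; inj₁; inj₂)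
open import Data.Vec.Base using (Vec; []; _∷_; count; lookup)
open import Function.Base using (_∘_; id)
open import Relation.Binary.PropositionalEquality using
  (_≡_; _≢_; refl; sym; trans; cong; cong₂; subst; subst₂; setoid)
open import Relation.Nullary using (¬_; Dec; yes; no; does; ¬?; contradiction; _×-dec_; decidable-stable)
open import Relation.Unary using (Pred; Decidable)

-- Let every two symbols be at distance at most d, and let t ≥ 3d + 3 - n.  The
-- neighbourhood of a position p and its mate has at most p + 3d + 2 elements and
-- carries all n symbols, so fewer than p + t of the first 3t positions have their
-- mate near the mate of p.  If also 3t ≤ d + 1 and 6t + 2d + 2 ≤ n,
-- then the mates of those of the first 3t positions that come within reach of the
-- last 3t positions are near each other, so they are few as well, and two of the
-- first 3t positions remain whose mates are far from each other and out of reach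
-- of the right end.  By symmetry, the same holds for the last 3t positions.  Every left and every right
-- mate found this way are near each other, so the four mates form an induced
-- 4-cycle in a unit interval graph, which is impossible.
-- With n = 23r, the numbers d = 8r - 1 and t = r satisfy these inequalities.

-- Unit interval graphs on positions

Close : ℕ → ℕ → ℕ → Set
Close d x y = x ≤ y + d × y ≤ x + d

close? : ∀ d x y → Dec (Close d x y)
close? d x y = (x ≤? y + d) ×-dec (y ≤? x + d)

¬close⇒apart : ∀ {d} x y → ¬ Close d x y → y + d < x ⊎ x + d < y
¬close⇒apart {d} x y ¬c with x ≤? y + d | y ≤? x + d
... | no p  | _     = inj₁ (≰⇒> p)
... | yes _ | no q  = inj₂ (≰⇒> q)
... | yes p | yes q = contradiction (p , q) ¬c

-- Say `e + d < c`. Then `a ≤ e + d < c ≤ b + d`, and likewise with `a` and `b` exchanged; the case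
-- `c + d < e` is symmetric.
no-induced-C4 : ∀ {d a b c e} → Close d a c → Close d a e → Close d b c → Close d b e →
                ¬ Close d c e → Close d a b
no-induced-C4 {c = c} {e} (a≤c , c≤a) (a≤e , e≤a) (b≤c , c≤b) (b≤e , e≤b) ¬ce with ¬close⇒apart c e ¬ce
... | inj₁ e<c = ≤-trans a≤e (≤-trans (<⇒≤ e<c) c≤b) , ≤-trans b≤e (≤-trans (<⇒≤ e<c) c≤a)
... | inj₂ c<e = ≤-trans a≤c (≤-trans (<⇒≤ c<e) e≤b) , ≤-trans b≤c (≤-trans (<⇒≤ c<e) e≤a)

-- Counting in lists

module _ {a p q} {A : Set a} {P : Pred A p} {Q : Pred A q} (P? : Decidable P) (Q? : Decidable Q) where

  -- Pigeonhole: if no entry satisfied both predicates, each would be counted at most once, and the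
  -- two counts could not add up to more than `length xs`.
  filter-overlap : ∀ xs → length xs < length (filter P? xs) + length (filter Q? xs) →
                   ∃[ x ] (P x × Q x)
  filter-overlap (x ∷ xs) lt with P? x | Q? x
  ... | yes px | yes qx = x , px , qx
  ... | yes px | no ¬qx = filter-overlap xs (s≤s⁻¹ lt)
  ... | no ¬px | yes qx = filter-overlap xs (s≤s⁻¹ (subst (suc (length xs) <_) (+-suc (length (filter P? xs)) (length (filter Q? xs))) lt))
  ... | no ¬px | no ¬qx = filter-overlap xs (<-trans (n<1+n _) lt)

  length-filter-mono : (∀ {x} → P x → Q x) → ∀ xs → length (filter P? xs) ≤ length (filter Q? xs)
  length-filter-mono P⇒Q xs =
    length-mono-≤ (⊆-filter-Sublist P? Q? (λ { refl → P⇒Q }) (⊆-refl {x = xs}))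

length-filter-tabulate : ∀ {a p} {A : Set a} {P : Pred A p} (P? : Decidable P) {m} (f : Fin m → A) t →
                         t ≤ m → (∀ x → toℕ x < t → P (f x)) → t ≤ length (filter P? (tabulate f))
length-filter-tabulate P? f zero    _         _  = z≤n
length-filter-tabulate P? {suc m} f (suc t) (s≤s t≤m) Pf
  rewrite filter-accept P? {xs = tabulate (f ∘ suc)} (Pf zero (s≤s z≤n)) =
  s≤s (length-filter-tabulate P? (f ∘ suc) t t≤m (λ x x<t → Pf (suc x) (s≤s x<t)))

range : ℕ → ℕ → List ℕ
range a k = applyUpTo (λ i → a + i) k

∈-range : ∀ {a k y} → a ≤ y → y < a + k → y ∈ range a k
∈-range {a} {k} {y} a≤y y<a+k =
  subst (_∈ range a k) (m+[n∸m]≡n a≤y)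
    (∈-applyUpTo⁺ (λ i → a + i) (+-cancelˡ-< a (y ∸ a) k (subst (_< a + k) (sym (m+[n∸m]≡n a≤y)) y<a+k)))

-- Double strings and covering bounds

-- mate x is the other occurrence of the symbol at position x.
record DoubleString (n N d : ℕ) : Set where
  field
    label       : Fin N → Fin n
    mate        : Fin N → Fin N
    label-mate  : ∀ x → label (mate x) ≡ label x
    label-fibre : ∀ x {y} → label y ≡ label x → y ≡ x ⊎ y ≡ mate x
    reach       : ∀ x b → ∃[ y ] (label y ≡ b × (Close d (toℕ x) (toℕ y) ⊎ Close d (toℕ (mate x)) (toℕ y)))

module _ {n N d} (S : DoubleString n N d) where
  open DoubleString S

  -- A position carries only one symbol, so sending each symbol to the index in `xs` of its chosen
  -- occurrence is injective.
  covering-length : (xs : List ℕ) → (∀ b → ∃[ y ] (label y ≡ b × toℕ y ∈ xs)) → n ≤ length xs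
  covering-length xs cover = injective⇒≤ {f = λ b → index (proj₂ (proj₂ (cover b)))} inj
    where
    inj : ∀ {a b} → index (proj₂ (proj₂ (cover a))) ≡ index (proj₂ (proj₂ (cover b))) → a ≡ b
    inj {a} {b} eq with cover a | cover b
    ... | x , la , x∈ | y , lb , y∈ =
      trans (sym la) (trans (cong label (toℕ-injective (Membership.index-injective (setoid ℕ) x∈ y∈ eq))) lb)

  -- Every symbol occurs at a position up to `x + d` or at one from `mate x ∸ d` on. If `mate x`
  -- were too far to the right, there would be fewer than `n` such positions.
  mate-bound : ∀ x → n + toℕ (mate x) ≤ suc (toℕ x) + d + d + N
  mate-bound x = begin
    n + q                              ≤⟨ +-mono-≤ (covering-length xs cover) (m≤n+m∸n q d) ⟩
    length xs + (d + lo)               ≡⟨ cong (λ l → l + (d + lo)) len ⟩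
    suc (p + d) + (N ∸ lo) + (d + lo)  ≡⟨ rearrange p d (N ∸ lo) lo ⟩
    suc p + d + d + (lo + (N ∸ lo))    ≡⟨ cong (λ l → suc p + d + d + l) (m+[n∸m]≡n lo≤N) ⟩
    suc p + d + d + N                  ∎
    where
    p = toℕ x
    q = toℕ (mate x)
    lo = q ∸ d
    lo≤N : lo ≤ N
    lo≤N = ≤-trans (m∸n≤m q d) (<⇒≤ (toℕ<n (mate x)))
    xs = upTo (suc (p + d)) ++ range lo (N ∸ lo)
    cover : ∀ b → ∃[ y ] (label y ≡ b × toℕ y ∈ xs)
    cover b with reach x b
    ... | y , eq , inj₁ (_ , y≤) = y , eq , ∈-++⁺ˡ (∈-upTo⁺ (s≤s y≤))
    ... | y , eq , inj₂ (q≤ , _) = y , eq , ∈-++⁺ʳ (upTo (suc (p + d)))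
            (∈-range (m≤n+o⇒m∸n≤o q d (subst (q ≤_) (+-comm _ d) q≤))
                     (subst (toℕ y <_) (sym (m+[n∸m]≡n lo≤N)) (toℕ<n y)))
    len : length xs ≡ suc (p + d) + (N ∸ lo)
    len = begin-equality
      length xs  ≡⟨ length-++ (upTo (suc (p + d))) ⟩
      length (upTo (suc (p + d))) + length (range lo (N ∸ lo))
        ≡⟨ cong₂ _+_ (length-upTo (suc (p + d))) (length-applyUpTo (λ i → lo + i) (N ∸ lo)) ⟩
      suc (p + d) + (N ∸ lo) ∎
      where open ≤-Reasoning
    rearrange : ∀ p d m lo → suc (p + d) + m + (d + lo) ≡ suc p + d + d + (lo + m)
    rearrange = solve-∀
    open ≤-Reasoning

  module _ {K} (K≤N : K ≤ N) where

    emb : Fin K → Fin N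
    emb x = inject≤ x K≤N

    toℕ-emb : ∀ x → toℕ (emb x) ≡ toℕ x
    toℕ-emb x = toℕ-inject≤ x K≤N

    far? : ∀ p → Decidable (λ x → ¬ Close d (toℕ (mate p)) (toℕ (mate (emb x))))
    far? p x = ¬? (close? d (toℕ (mate p)) (toℕ (mate (emb x))))

    -- The positions near p or mate p carry every symbol, also after deleting
    -- each x < K for which mate x is near mate p.
    far-mates : ∀ p → K ≤ toℕ p + suc d →
                n + K ≤ length (filter (far? p) (allFin K)) + (toℕ p + suc d) + suc (d + d)
    far-mates p K≤ = begin
      n + K                    ≤⟨ +-monoˡ-≤ K (covering-length xs cover) ⟩
      length xs + K            ≡⟨ cong (λ l → l + K) len ⟩
      f + (m + suc (d + d)) + K ≡⟨ rearrange f m (suc (d + d)) K ⟩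
      f + (K + m) + suc (d + d) ≡⟨ cong (λ l → f + l + suc (d + d)) (m+[n∸m]≡n K≤) ⟩
      f + (toℕ p + suc d) + suc (d + d) ∎
      where
      q = toℕ (mate p)
      fs = filter (far? p) (allFin K)
      f = length fs
      m = toℕ p + suc d ∸ K
      ps = map toℕ fs
      -- If `q < d`, the left end is truncated to 0 and the window extends beyond `q + d`; it still
      -- contains all positions near `q`.
      window = range (q ∸ d) (suc (d + d))
      xs = ps ++ (range K m ++ window)
      in-window : ∀ {y} → Close d q y → y ∈ window
      in-window {y} (q≤ , y≤) = ∈-range (m≤n+o⇒m∸n≤o q d (subst (q ≤_) (+-comm _ d) q≤)) (begin
        suc y                    ≤⟨ s≤s y≤ ⟩
        suc (q + d)              ≤⟨ s≤s (+-monoˡ-≤ d (m≤n+m∸n q d)) ⟩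
        suc (d + (q ∸ d) + d)    ≡⟨ rearrange′ d (q ∸ d) ⟩
        (q ∸ d) + suc (d + d)    ∎)
        where
        rearrange′ : ∀ d l → suc (d + l + d) ≡ l + suc (d + d)
        rearrange′ = solve-∀
        open ≤-Reasoning
      window⊆xs : ∀ {y} → Close d q y → y ∈ xs
      window⊆xs c = ∈-++⁺ʳ ps (∈-++⁺ʳ (range K m) (in-window c))
      cover : ∀ b → ∃[ y ] (label y ≡ b × toℕ y ∈ xs)
      cover b with reach p b
      ... | y , eq , inj₂ c = y , eq , window⊆xs c
      ... | y , eq , inj₁ (_ , y≤) with K ≤? toℕ y
      ...   | yes K≤y = y , eq , ∈-++⁺ʳ ps (∈-++⁺ˡ (∈-range K≤y
              (subst (toℕ y <_) (sym (m+[n∸m]≡n K≤)) (subst (toℕ y <_) (sym (+-suc (toℕ p) d)) (s≤s y≤)))))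
      ...   | no K≰y with close? d q (toℕ (mate y))
      -- The symbol of a deleted `y` is still found at `mate y`, inside the window.
      ...     | yes c = mate y , trans (label-mate y) eq , window⊆xs c
      ...     | no ¬c = y , eq , ∈-++⁺ˡ (subst (_∈ ps) (toℕ-fromℕ< y<K) (∈-map⁺ toℕ (∈-filter⁺ (far? p) (∈-allFin y′) far)))
        where
        y<K = ≰⇒> K≰y
        y′ = fromℕ< y<K
        emb-y′ : emb y′ ≡ y
        emb-y′ = toℕ-injective (trans (toℕ-emb y′) (toℕ-fromℕ< y<K))
        far : ¬ Close d q (toℕ (mate (emb y′)))
        far = subst (λ z → ¬ Close d q (toℕ (mate z))) (sym emb-y′) ¬c
      len : length xs ≡ f + (m + suc (d + d))
      len = begin-equality
        length xs  ≡⟨ length-++ ps ⟩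
        length ps + length (range K m ++ window)
          ≡⟨ cong₂ _+_ (length-map toℕ fs) (length-++ (range K m)) ⟩
        f + (length (range K m) + length window)
          ≡⟨ cong (λ l → f + l) (cong₂ _+_ (length-applyUpTo (λ i → K + i) m) (length-applyUpTo (λ i → (q ∸ d) + i) (suc (d + d)))) ⟩
        f + (m + suc (d + d)) ∎
        where open ≤-Reasoning
      rearrange : ∀ f m w K → f + (m + w) + K ≡ f + (K + m) + w
      rearrange = solve-∀
      open ≤-Reasoning

-- Two left positions with interior mates far from each other

Interior : ∀ {n N d} → DoubleString n N d → ℕ → Fin N → Set
Interior {N = N} {d} S t x = toℕ x < 3 * t × toℕ (mate x) + (3 * t + d) < N
  where open DoubleString S

module _ {n N d} (S : DoubleString n N d) (t : ℕ) (K≤N : 3 * t ≤ N)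
         (0<t : 0 < t) (3t≤d+1 : 3 * t ≤ suc d)
         (3d+3≤n+t : 3 * suc d ≤ n + t) (6t+2d+2≤n : 6 * t + 2 * suc d ≤ n) where
  open DoubleString S

  private
    K = 3 * t
    e = emb S K≤N

    y : Fin K → ℕ
    y x = toℕ (mate (e x))

    -- mate x is out of reach of the last 3t positions.
    Good : Fin K → Set
    Good x = y x + (K + d) < N

    good? : Decidable Good
    good? x = y x + (K + d) <? N

    Far : Fin K → Fin K → Set
    Far p x = ¬ Close d (y p) (y x)

    #good = length (filter good? (allFin K))

    #far : Fin K → ℕ
    #far p = length (filter (far? S K≤N (e p)) (allFin K))

    -- `far-mates` gives `n + 3t ≤ #far p + p + 3d + 2`, and `3d + 3 ≤ n + t` turns this into more
    -- than `2t - p` far mates. The bound is strongest for small `p`.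
    #far-bound : ∀ p → 2 * t < #far p + toℕ p
    #far-bound p = +-cancelˡ-≤ (n + t) (suc (2 * t)) (#far p + toℕ p) (begin
      n + t + suc (2 * t)                           ≡⟨ eq₁ n t ⟩
      suc (n + 3 * t)                               ≤⟨ s≤s (far-mates S K≤N (e p) K≤) ⟩
      suc (#far p + (toℕ (e p) + suc d) + suc (d + d)) ≡⟨ cong (λ i → suc (#far p + (i + suc d) + suc (d + d))) (toℕ-emb S K≤N p) ⟩
      suc (#far p + (toℕ p + suc d) + suc (d + d))  ≡⟨ eq₂ (#far p) (toℕ p) d ⟩
      3 * suc d + (#far p + toℕ p)                  ≤⟨ +-monoˡ-≤ (#far p + toℕ p) 3d+3≤n+t ⟩
      n + t + (#far p + toℕ p)                      ∎)
      where
      open ≤-Reasoning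
      K≤ : K ≤ toℕ (e p) + suc d
      K≤ = ≤-trans 3t≤d+1 (m≤n+m (suc d) (toℕ (e p)))
      eq₁ : ∀ n t → n + t + suc (2 * t) ≡ suc (n + 3 * t)
      eq₁ = solve-∀
      eq₂ : ∀ f p d → suc (f + (p + suc d) + suc (d + d)) ≡ 3 * suc d + (f + p)
      eq₂ = solve-∀

    -- The mate of a bad `b` is at `N - 3t - d` or later, while `mate-bound` keeps `y a` at or below
    -- `N + 3t + 2d - n`. As `6t + 2d + 2 ≤ n`, the second number exceeds the first by less than
    -- `d`. In particular, any two bad positions have close mates.
    bad-close : ∀ {a b} → ¬ Good b → y a ≤ y b + d
    bad-close {a} {b} ¬gb = +-cancelˡ-≤ (n + N + 3 * t) (y a) (y b + d) (begin
      n + N + 3 * t + y a                        ≡⟨ eq₁ n N t (y a) ⟩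
      N + 3 * t + (n + y a)                      ≤⟨ +-mono-≤ (+-monoˡ-≤ (3 * t) (≮⇒≥ ¬gb)) (mate-bound S (e a)) ⟩
      y b + (K + d) + 3 * t + (suc (toℕ (e a)) + d + d + N)
        ≤⟨ +-monoʳ-≤ (y b + (K + d) + 3 * t) (+-monoˡ-≤ N (+-monoˡ-≤ d (+-monoˡ-≤ d a<K))) ⟩
      y b + (K + d) + 3 * t + (3 * t + d + d + N) ≤⟨ m≤m+n _ 2 ⟩
      y b + (K + d) + 3 * t + (3 * t + d + d + N) + 2 ≡⟨ eq₂ t (y b) d N ⟩
      6 * t + 2 * suc d + (N + 3 * t + (y b + d)) ≤⟨ +-monoˡ-≤ (N + 3 * t + (y b + d)) 6t+2d+2≤n ⟩
      n + (N + 3 * t + (y b + d))                ≡⟨ eq₃ n N (3 * t) (y b + d) ⟩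
      n + N + 3 * t + (y b + d)                  ∎)
      where
      open ≤-Reasoning
      a<K : suc (toℕ (e a)) ≤ 3 * t
      a<K = subst (_< 3 * t) (sym (toℕ-emb S K≤N a)) (toℕ<n a)
      eq₁ : ∀ n N t y → n + N + 3 * t + y ≡ N + 3 * t + (n + y)
      eq₁ = solve-∀
      eq₂ : ∀ t y d N → y + (3 * t + d) + 3 * t + (3 * t + d + d + N) + 2 ≡ 6 * t + 2 * suc d + (N + 3 * t + (y + d))
      eq₂ = solve-∀
      eq₃ : ∀ n N k z → n + (N + k + z) ≡ n + N + k + z
      eq₃ = solve-∀

    -- Whatever is far from a bad `b` must be good, because two bad positions have close mates;
    -- hence `#good` is at least `#far b`.
    bad⇒#good : ∀ {b} → ¬ Good b → 2 * t < #good + toℕ b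
    bad⇒#good {b} ¬gb = <-≤-trans (#far-bound b) (+-monoˡ-≤ (toℕ b)
      (length-filter-mono (far? S K≤N (e b)) good? (λ {x} far →
         decidable-stable (good? x) (λ ¬gx → far (bad-close ¬gx , bad-close ¬gb))) (allFin K)))

    t≤K : t ≤ K
    t≤K = m≤m+n t (t + (t + 0))

    pair-from : ∀ {p} → Good p → 3 * t < #good + #far p → ∃[ p ] ∃[ x ] (Good p × Good x × Far p x)
    pair-from {p} gp lt with filter-overlap good? (far? S K≤N (e p)) (allFin K)
      (subst (_< #good + #far p) (sym (length-tabulate {n = K} id)) lt)
    ... | x , gx , far = p , x , gp , gx , far

    -- Either the first `t` positions are all good, or a bad `b < t` yields more than `2t - b > t`
    -- good ones.
    #good≥t : t ≤ #good
    #good≥t with any? (λ b → (toℕ b <? t) ×-dec ¬? (good? b))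
    ... | no ¬bad = length-filter-tabulate good? id t t≤K
            (λ x x<t → decidable-stable (good? x) (λ ¬g → ¬bad (x , x<t , ¬g)))
    ... | yes (b , b<t , ¬gb) = +-cancelʳ-≤ t t #good (begin
      t + t             ≡⟨ eq t ⟩
      2 * t             ≤⟨ <⇒≤ (bad⇒#good ¬gb) ⟩
      #good + toℕ b     ≤⟨ +-monoʳ-≤ #good (<⇒≤ b<t) ⟩
      #good + t         ∎)
      where
      open ≤-Reasoning
      eq : ∀ t → t + t ≡ 2 * t
      eq = solve-∀

    first : Fin K
    first = fromℕ< (≤-trans 0<t t≤K)

    toℕ-first : toℕ first ≡ 0
    toℕ-first = toℕ-fromℕ< (≤-trans 0<t t≤K)

    drop-first : ∀ {m} → 2 * t < m + toℕ first → 2 * t < m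
    drop-first {m} = subst (2 * t <_) (trans (cong (λ i → m + i) toℕ-first) (+-identityʳ m))

    first-bad : ¬ Good first → ∃[ p ] (Good p × toℕ p < t)
    first-bad ¬g = filter-overlap good? (λ x → toℕ x <? t) (allFin K) (begin-strict
      length (allFin K)  ≡⟨ length-tabulate {n = K} id ⟩
      3 * t              ≡⟨ eq t ⟩
      2 * t + t          <⟨ +-mono-<-≤ (drop-first (bad⇒#good ¬g)) (length-filter-tabulate (λ x → toℕ x <? t) id t t≤K (λ _ lt → lt)) ⟩
      #good + length (filter (λ x → toℕ x <? t) (allFin K)) ∎)
      where
      open ≤-Reasoning
      eq : ∀ t → 3 * t ≡ 2 * t + t
      eq = solve-∀

    -- For `pair-from`, a good `p` with `#good + #far p > 3t` is needed. If position 0 is good, it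
    -- has more than `2t` far mates, and `t` good positions suffice. If it is bad, there are more
    -- than `2t` good positions, so one of them is some `p < t`, which has more than `t` far mates.
    far-good-pair : ∃[ p ] ∃[ x ] (Good p × Good x × Far p x)
    far-good-pair with good? first
    ... | yes g = pair-from g (begin-strict
        3 * t              ≡⟨ eq t ⟩
        t + 2 * t          <⟨ +-mono-≤-< #good≥t (drop-first (#far-bound first)) ⟩
        #good + #far first ∎)
      where
      open ≤-Reasoning
      eq : ∀ t → 3 * t ≡ t + 2 * t
      eq = solve-∀
    ... | no ¬g with first-bad ¬g
    ...   | p , gp , p<t = pair-from gp (+-cancelʳ-< t (3 * t) (#good + #far p) (begin-strict
        3 * t + t                     ≡⟨ eq t ⟩
        2 * t + 2 * t                 <⟨ +-mono-< (drop-first (bad⇒#good ¬g)) (#far-bound p) ⟩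
        #good + (#far p + toℕ p)      ≡⟨ +-assoc #good (#far p) (toℕ p) ⟨
        #good + #far p + toℕ p        ≤⟨ +-monoʳ-≤ (#good + #far p) (<⇒≤ p<t) ⟩
        #good + #far p + t            ∎))
      where
      open ≤-Reasoning
      eq : ∀ t → 3 * t + t ≡ 2 * t + 2 * t
      eq = solve-∀

  interior-pair : ∃[ p ] ∃[ x ] (Interior S t p × Interior S t x × ¬ Close d (toℕ (mate p)) (toℕ (mate x)))
  interior-pair with far-good-pair
  ... | p , x , gp , gx , far = e p , e x , (e<K p , gp) , (e<K x , gx) , far
    where
    e<K : ∀ x → toℕ (e x) < 3 * t
    e<K x = subst (_< 3 * t) (sym (toℕ-emb S K≤N x)) (toℕ<n x)

-- Reversal of a double string

toℕ+opposite : ∀ {N} (i : Fin N) → toℕ (opposite i) + suc (toℕ i) ≡ N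
toℕ+opposite {N} i = trans (cong (λ k → k + suc (toℕ i)) (opposite-prop i)) (m∸n+n≡m (toℕ<n i))

opposite-≤ : ∀ {N d} (i j : Fin N) → toℕ j ≤ toℕ i + d → toℕ (opposite i) ≤ toℕ (opposite j) + d
opposite-≤ {N} {d} i j j≤ = +-cancelʳ-≤ (suc (toℕ j)) (toℕ (opposite i)) (toℕ (opposite j) + d) (begin
  toℕ (opposite i) + suc (toℕ j)        ≤⟨ +-monoʳ-≤ (toℕ (opposite i)) (s≤s j≤) ⟩
  toℕ (opposite i) + (suc (toℕ i) + d)  ≡⟨ +-assoc (toℕ (opposite i)) (suc (toℕ i)) d ⟨
  toℕ (opposite i) + suc (toℕ i) + d    ≡⟨ cong (λ k → k + d) (trans (toℕ+opposite i) (sym (toℕ+opposite j))) ⟩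
  toℕ (opposite j) + suc (toℕ j) + d    ≡⟨ eq (toℕ (opposite j)) (suc (toℕ j)) d ⟩
  toℕ (opposite j) + d + suc (toℕ j)    ∎)
  where
  open ≤-Reasoning
  eq : ∀ a b c → a + b + c ≡ a + c + b
  eq = solve-∀

close-opposite : ∀ {N d} (i j : Fin N) → Close d (toℕ i) (toℕ j) → Close d (toℕ (opposite i)) (toℕ (opposite j))
close-opposite i j (i≤ , j≤) = opposite-≤ i j j≤ , opposite-≤ j i i≤

-- Conjugation by `opposite` preserves closeness, so what is proved about the left end of every
-- double string carries over to the right end.
mirror : ∀ {n N d} → DoubleString n N d → DoubleString n N d
mirror {n} {N} {d} S = record
  { label       = λ x → label (opposite x)
  ; mate        = λ x → opposite (mate (opposite x))
  ; label-mate  = λ x → trans (cong label (opposite-involutive (mate (opposite x)))) (label-mate (opposite x))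
  ; label-fibre = fibre
  ; reach       = reach′
  }
  where
  open DoubleString S
  fibre : ∀ x {y} → label (opposite y) ≡ label (opposite x) → y ≡ x ⊎ y ≡ opposite (mate (opposite x))
  fibre x {y} eq with label-fibre (opposite x) eq
  ... | inj₁ r = inj₁ (trans (sym (opposite-involutive y)) (trans (cong opposite r) (opposite-involutive x)))
  ... | inj₂ r = inj₂ (trans (sym (opposite-involutive y)) (cong opposite r))
  reach′ : ∀ x b → ∃[ y ] (label (opposite y) ≡ b ×
    (Close d (toℕ x) (toℕ y) ⊎ Close d (toℕ (opposite (mate (opposite x)))) (toℕ y)))
  reach′ x b with reach (opposite x) b
  ... | y , eq , c = opposite y , trans (cong label (opposite-involutive y)) eq , close c
    where
    close : Close d (toℕ (opposite x)) (toℕ y) ⊎ Close d (toℕ (mate (opposite x))) (toℕ y) →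
            Close d (toℕ x) (toℕ (opposite y)) ⊎ Close d (toℕ (opposite (mate (opposite x)))) (toℕ (opposite y))
    close (inj₁ c) = inj₁ (subst (λ z → Close d (toℕ z) (toℕ (opposite y))) (opposite-involutive x) (close-opposite (opposite x) y c))
    close (inj₂ c) = inj₂ (close-opposite (mate (opposite x)) y c)

-- The contradiction between the two ends

module _ {n N d} (S : DoubleString n N d) (N≡n+n : N ≡ n + n) (t : ℕ)
         (0<t : 0 < t) (3t≤d+1 : 3 * t ≤ suc d)
         (3d+3≤n+t : 3 * suc d ≤ n + t) (6t+2d+2≤n : 6 * t + 2 * suc d ≤ n) where
  open DoubleString S

  private
    6t+2d+2≤N : 6 * t + 2 * suc d ≤ N
    6t+2d+2≤N = ≤-trans 6t+2d+2≤n (subst (n ≤_) (sym N≡n+n) (m≤m+n n n))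

    3t≤N : 3 * t ≤ N
    3t≤N = ≤-trans (*-monoˡ-≤ t (m≤m+n 3 3)) (m+n≤o⇒m≤o (6 * t) 6t+2d+2≤N)

    -- By `reach`, `p` or its mate is close to `opposite r` or its mate. Of the four combinations,
    -- three are impossible: each mate is out of reach of the opposite end, and the two ends are out
    -- of reach of each other. Only the two mates remain.
    opposite-ends-close : ∀ {p r} → Interior S t p → Interior (mirror S) t r →
                          Close d (toℕ (mate p)) (toℕ (mate (opposite r)))
    opposite-ends-close {p} {r} (p<3t , mp) (r<3t , mr) with reach p (label (opposite r))
    ... | y , eq , c with label-fibre (opposite r) eq | c
    ...   | inj₂ refl | inj₂ c′ = c′
    ...   | inj₂ refl | inj₁ (_ , z≤) = contradiction (begin-strict
              N                              ≡⟨ toℕ+opposite z ⟨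
              toℕ (opposite z) + suc (toℕ z) ≤⟨ +-monoʳ-≤ (toℕ (opposite z)) (s≤s z≤) ⟩
              toℕ (opposite z) + (suc (toℕ p) + d) ≤⟨ +-monoʳ-≤ (toℕ (opposite z)) (+-monoˡ-≤ d p<3t) ⟩
              toℕ (opposite z) + (3 * t + d) <⟨ mr ⟩
              N                              ∎) (<-irrefl refl)
            where
            open ≤-Reasoning
            z = mate (opposite r)
    ...   | inj₁ refl | inj₂ (_ , z≤) = contradiction (begin-strict
              N                                   ≡⟨ toℕ+opposite r ⟨
              toℕ (opposite r) + suc (toℕ r)      ≤⟨ +-mono-≤ z≤ r<3t ⟩
              toℕ (mate p) + d + 3 * t            ≡⟨ eq₁ (toℕ (mate p)) d (3 * t) ⟩
              toℕ (mate p) + (3 * t + d)          <⟨ mp ⟩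
              N                                   ∎) (<-irrefl refl)
            where
            open ≤-Reasoning
            eq₁ : ∀ a d k → a + d + k ≡ a + (k + d)
            eq₁ = solve-∀
    ...   | inj₁ refl | inj₁ (_ , z≤) = contradiction (begin-strict
              N                                   ≡⟨ toℕ+opposite r ⟨
              toℕ (opposite r) + suc (toℕ r)      ≤⟨ +-mono-≤ z≤ r<3t ⟩
              toℕ p + d + 3 * t                   <⟨ +-monoˡ-< (3 * t) (+-monoˡ-< d p<3t) ⟩
              3 * t + d + 3 * t                   ≤⟨ m≤m+n _ (d + 2) ⟩
              3 * t + d + 3 * t + (d + 2)         ≡⟨ eq₁ t d ⟩
              6 * t + 2 * suc d                   ≤⟨ 6t+2d+2≤N ⟩
              N                                   ∎) (<-irrefl refl)
            where
            open ≤-Reasoning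
            eq₁ : ∀ t d → 3 * t + d + 3 * t + (d + 2) ≡ 6 * t + 2 * suc d
            eq₁ = solve-∀

  no-double-string : ⊥
  no-double-string
    with interior-pair S t 3t≤N 0<t 3t≤d+1 3d+3≤n+t 6t+2d+2≤n
       | interior-pair (mirror S) t 3t≤N 0<t 3t≤d+1 3d+3≤n+t 6t+2d+2≤n
  ... | p , p′ , ip , ip′ , p≁p′ | r , r′ , ir , ir′ , r≁r′ =
    -- `r` and `r′` have far mates in the mirrored string; if their mates in `S` were close,
    -- `close-opposite` would make the mirrored ones close too.
    p≁p′ (no-induced-C4 (opposite-ends-close ip ir) (opposite-ends-close ip ir′)
                        (opposite-ends-close ip′ ir) (opposite-ends-close ip′ ir′)
                        (λ c → r≁r′ (close-opposite _ _ c)))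

-- From double words to double strings

module _ {a p b} {A : Set a} {B : Set b} {P : Pred A p} (P? : Decidable P) (g : B → A) where

  -- Translates the `count` in `IsDouble` into the length of `positions`. An arbitrary `f` is
  -- allowed so that the induction can pass to `f ∘ suc`.
  length-filter≡count : ∀ {m} (v : Vec A m) (f : Fin m → B) → (∀ i → g (f i) ≡ lookup v i) →
                        length (filter (λ x → P? (g x)) (tabulate f)) ≡ count P? v
  length-filter≡count []      f gf = refl
  length-filter≡count (x ∷ v) f gf rewrite gf zero with does (P? x)
  ... | true  = cong suc (length-filter≡count v (f ∘ suc) (gf ∘ suc))
  ... | false = length-filter≡count v (f ∘ suc) (gf ∘ suc)

length-2 : ∀ {a} {A : Set a} (xs : List A) → length xs ≡ 2 → ∃[ p ] ∃[ q ] (xs ≡ p ∷ q ∷ [])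
length-2 (p ∷ q ∷ []) refl = p , q , refl

length-2-other : ∀ {a} {A : Set a} {xs : List A} {x} → length xs ≡ 2 → x ∈ xs →
                 ∃[ m ] (m ∈ xs × (∀ {y} → y ∈ xs → y ≡ x ⊎ y ≡ m))
length-2-other {xs = p ∷ q ∷ []} refl (here refl) =
  q , there (here refl) , λ { (here e) → inj₁ e ; (there (here e)) → inj₂ e }
length-2-other {xs = p ∷ q ∷ []} refl (there (here refl)) =
  p , here refl , λ { (here e) → inj₂ e ; (there (here e)) → inj₁ e }

∣-∣≤⇒close : ∀ {d} x y → ∣ x - y ∣ ≤ d → Close d x y
∣-∣≤⇒close x y le = ≤-trans (m≤n+∣m-n∣ x y) (+-monoʳ-≤ y le) , ≤-trans (m≤n+∣n-m∣ y x) (+-monoʳ-≤ x le)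

module _ {n} (w : Word n) (w-double : IsDouble w) where

  ∈-positions : ∀ {a} i → lookup w i ≡ a → i ∈ positions w a
  ∈-positions {a} i eq = ∈-filter⁺ (λ i → lookup w i Fin.≟ a) (∈-allFin i) eq

  positions-label : ∀ {a i} → i ∈ positions w a → lookup w i ≡ a
  positions-label {a} i∈ = proj₂ (∈-filter⁻ (λ i → lookup w i Fin.≟ a) {xs = allFin (2 * n)} i∈)

  length-positions : ∀ a → length (positions w a) ≡ 2
  length-positions a = trans (length-filter≡count (Fin._≟ a) (lookup w) w id (λ _ → refl)) (w-double a)

  partner : ∀ x → ∃[ m ] (m ∈ positions w (lookup w x) × (∀ {y} → y ∈ positions w (lookup w x) → y ≡ x ⊎ y ≡ m))
  partner x = length-2-other (length-positions (lookup w x)) (∈-positions x refl)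

  private
    gap : Fin (2 * n) → Fin (2 * n) → ℕ
    gap i j = ∣ toℕ i - toℕ j ∣

  distance-attained : ∀ a b → ∃[ i ] ∃[ j ] (lookup w i ≡ a × lookup w j ≡ b × distance w a b ≡ ∣ toℕ i - toℕ j ∣)
  distance-attained a b
    with p , _ , eqa ← length-2 (positions w a) (length-positions a)
       | q , _ , eqb ← length-2 (positions w b) (length-positions b)
    with i , j , i∈ , j∈ , eq ← ∈-cartesianProductWith⁻ gap (positions w a) (positions w b)
           (minimum-∈ (∈-cartesianProductWith⁺ gap (subst (p ∈_) (sym eqa) (here refl)) (subst (q ∈_) (sym eqb) (here refl))))
    = i , j , positions-label i∈ , positions-label j∈ , eq

  distance≤diameter : ∀ {a b} → a ≢ b → distance w a b ≤ diameter w
  distance≤diameter {a} {b} a≢b =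
    All.lookup (xs≤max 0 (map (uncurry (distance w)) (distinctPairs n)))
      (∈-map⁺ (uncurry (distance w))
        (∈-filter⁺ (λ (a , b) → ¬? (a Fin.≟ b)) (∈-cartesianProduct⁺ (∈-allFin a) (∈-allFin b)) a≢b))

  doubleString : ∀ {d} → diameter w ≤ d → DoubleString n (2 * n) d
  doubleString {d} diam≤d = record
    { label       = lookup w
    ; mate        = mate
    ; label-mate  = λ x → positions-label (proj₁ (proj₂ (partner x)))
    ; label-fibre = fibre
    ; reach       = reach
    }
    where
    mate : Fin (2 * n) → Fin (2 * n)
    mate x = proj₁ (partner x)
    fibre : ∀ x {y} → lookup w y ≡ lookup w x → y ≡ x ⊎ y ≡ mate x
    fibre x eq = proj₂ (proj₂ (partner x)) (∈-positions _ eq)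
    reach : ∀ x b → ∃[ y ] (lookup w y ≡ b × (Close d (toℕ x) (toℕ y) ⊎ Close d (toℕ (mate x)) (toℕ y)))
    reach x b with lookup w x Fin.≟ b
    -- The diameter concerns distinct symbols only; for the symbol at `x` itself, `x` is the
    -- witness.
    ... | yes eq = x , eq , inj₁ (m≤m+n (toℕ x) d , m≤m+n (toℕ x) d)
    ... | no a≢b with distance-attained (lookup w x) b
    ...   | i , j , li , lj , eq = j , lj , near (fibre x li)
      where
      i~j : Close d (toℕ i) (toℕ j)
      i~j = ∣-∣≤⇒close (toℕ i) (toℕ j) (≤-trans (≤-reflexive (sym eq)) (≤-trans (distance≤diameter a≢b) diam≤d))
      near : i ≡ x ⊎ i ≡ mate x → Close d (toℕ x) (toℕ j) ⊎ Close d (toℕ (mate x)) (toℕ j)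
      near (inj₁ refl) = inj₁ i~j
      near (inj₂ refl) = inj₂ i~j

-- Bounds on δ and its lower limit

δ-bound : ∀ n D t → 0 < t → 3 * t ≤ D → 3 * D ≤ n + t → 6 * t + 2 * D ≤ n → D ≤ δ n
-- A positive `D` is written `suc d`, so that the negation of `D ≤ diameter w` is `diameter w ≤ d`.
δ-bound n zero    t _   _    _    _  = z≤n
δ-bound n (suc d) t 0<t 3t≤D 3D≤ 6t+2D≤n with w , dw , eq ← δ-attained n =
  subst (suc d ≤_) (sym eq) (≰⇒> λ diam≤d →
    no-double-string (doubleString w dw diam≤d) (cong (λ m → n + m) (+-identityʳ n)) t 0<t 3t≤D 3D≤ 6t+2D≤n)

-- With `D = 8r` and `t = r`, the condition `3D ≤ n + t` holds with equality, and `6t + 2D = 22r`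
-- leaves a slack of `r`.
δ[23r]≥8r : ∀ r → .{{_ : NonZero r}} → δ (23 * r) ≥ 8 * r
δ[23r]≥8r r@(suc _) = δ-bound (23 * r) (8 * r) r (s≤s z≤n) (*-monoˡ-≤ r (m≤m+n 3 5))
  (≤-reflexive (eq₁ r)) (subst (_≤ 23 * r) (eq₂ r) (*-monoˡ-≤ r (m≤m+n 22 1)))
  where
  eq₁ : ∀ r → 3 * (8 * r) ≡ 23 * r + r
  eq₁ = solve-∀
  eq₂ : ∀ r → 22 * r ≡ 6 * r + 2 * (8 * r)
  eq₂ = solve-∀

-- Writing n = 23k + m with m < 23, the bound applies with D = 8k + 8 ≥ 8n/23 and t = k + 24.
8n≤23δ : ∀ n → 23 * 160 ≤ n → 8 * n ≤ 23 * δ n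
8n≤23δ n n≥ = begin
  8 * n                        ≤⟨ *-monoʳ-≤ 8 n≤ ⟩
  8 * (23 * suc k)             ≡⟨ eq₁ k ⟩
  23 * (8 * suc k)             ≤⟨ *-monoʳ-≤ 23 (δ-bound n (8 * suc k) (k + 24) 0<t 3t≤D 3D≤n+t 6t+2D≤n) ⟩
  23 * δ n                     ∎
  where
  open ≤-Reasoning
  k = n DivMod./ 23
  m = n % 23
  n≡ : n ≡ m + k * 23
  n≡ = m≡m%n+[m/n]*n n 23
  -- The choice `t = k + 24` makes `3D = 23k + t`. Then `6t + 2D = 22k + 160`, which is at most
  -- `23k` once `k ≥ 160`; this gives the threshold `23 * 160`.
  k≥160 : 160 ≤ k
  k≥160 = DivMod./-monoˡ-≤ 23 n≥
  23k≤n : 23 * k ≤ n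
  23k≤n = subst (23 * k ≤_) (sym n≡) (subst (_≤ m + k * 23) (*-comm k 23) (m≤n+m (k * 23) m))
  n≤ : n ≤ 23 * suc k
  n≤ = begin
    n              ≡⟨ n≡ ⟩
    m + k * 23     ≤⟨ +-monoˡ-≤ (k * 23) (<⇒≤ (m%n<n n 23)) ⟩
    23 + k * 23    ≡⟨ *-comm (suc k) 23 ⟩
    23 * suc k     ∎
  0<t : 0 < k + 24
  0<t = ≤-trans (m≤m+n 1 23) (m≤n+m 24 k)
  3t≤D : 3 * (k + 24) ≤ 8 * suc k
  3t≤D = begin
    3 * (k + 24)         ≡⟨ eq k ⟩
    3 * k + 72           ≤⟨ +-monoʳ-≤ (3 * k) (≤-trans (m≤m+n 72 88) k≥160) ⟩
    3 * k + k            ≤⟨ m≤m+n (3 * k + k) (4 * k + 8) ⟩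
    3 * k + k + (4 * k + 8) ≡⟨ eq′ k ⟩
    8 * suc k            ∎
    where
    eq : ∀ k → 3 * (k + 24) ≡ 3 * k + 72
    eq = solve-∀
    eq′ : ∀ k → 3 * k + k + (4 * k + 8) ≡ 8 * suc k
    eq′ = solve-∀
  3D≤n+t : 3 * (8 * suc k) ≤ n + (k + 24)
  3D≤n+t = begin
    3 * (8 * suc k)      ≡⟨ eq k ⟩
    23 * k + (k + 24)    ≤⟨ +-monoˡ-≤ (k + 24) 23k≤n ⟩
    n + (k + 24)         ∎
    where
    eq : ∀ k → 3 * (8 * suc k) ≡ 23 * k + (k + 24)
    eq = solve-∀
  6t+2D≤n : 6 * (k + 24) + 2 * (8 * suc k) ≤ n
  6t+2D≤n = begin
    6 * (k + 24) + 2 * (8 * suc k) ≡⟨ eq k ⟩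
    22 * k + 160         ≤⟨ +-monoʳ-≤ (22 * k) k≥160 ⟩
    22 * k + k           ≡⟨ +-comm (22 * k) k ⟩
    23 * k               ≤⟨ 23k≤n ⟩
    n                    ∎
    where
    eq : ∀ k → 6 * (k + 24) + 2 * (8 * suc k) ≡ 22 * k + 160
    eq = solve-∀
  eq₁ : ∀ k → 8 * (23 * suc k) ≡ 23 * (8 * suc k)
  eq₁ = solve-∀

-- Since `_/_` reduces to lowest terms, the cross-multiplication is carried out on unnormalised
-- fractions.
/-mono-cross-≤ : ∀ a b c d .{{_ : NonZero b}} .{{_ : NonZero d}} → a * d ≤ c * b → + a / b ℚ.≤ + c / d
/-mono-cross-≤ a b@(suc b-1) c d@(suc d-1) ad≤cb = ℚ.toℚᵘ-cancel-≤ (begin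
  ℚ.toℚᵘ (+ a / b)       ≃⟨ ℚ.toℚᵘ-fromℚᵘ (ℚᵘ.mkℚᵘ (+ a) b-1) ⟩
  ℚᵘ.mkℚᵘ (+ a) b-1      ≤⟨ ℚᵘ.*≤* (subst₂ ℤ._≤_ (ℤ.pos-* a d) (ℤ.pos-* c b) (+≤+ ad≤cb)) ⟩
  ℚᵘ.mkℚᵘ (+ c) d-1      ≃⟨ ℚ.toℚᵘ-fromℚᵘ (ℚᵘ.mkℚᵘ (+ c) d-1) ⟨
  ℚ.toℚᵘ (+ c / d)       ∎)
  where open ℚᵘ.≤-Reasoning

8/23≤δ/n : ∀ n → .{{_ : NonZero n}} → 23 * 160 ≤ n → + 8 / 23 ℚ.≤ δ/n n
8/23≤δ/n n n≥ = /-mono-cross-≤ 8 23 (δ n) n (subst (8 * n ≤_) (*-comm 23 (δ n)) (8n≤23δ n n≥))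

theorem3p6 : ((r : ℕ) → .{{_ : NonZero r}} → δ (23 * r) ≥ 8 * r)
    × (+ 8 / 23 ≤liminf δ/n)
theorem3p6 = δ[23r]≥8r ,
  -- The bound `8/23` itself holds from `23 * 160` on, so one threshold serves every `q`.
  (λ q q<8/23 → 23 * 160 , λ n n≥ → ℚ.≤-trans (ℚ.<⇒≤ q<8/23) (8/23≤δ/n n n≥))
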